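{- There is an algorithm $\mathcal{A}$ which, given a set $W=\{s_1,\dots,s_n\}$ of $n$ binary strings, each of length $m$, and a target string $s\in\{0,1\}^m$, decides in time $O(m^2n)$ whether $s$ is representable by $W$ using only the operations $\wedge$ and $\vee$. Moreover, running $\mathcal{A}$ on the input $(W\cup\overline{W},s)$, where $\overline W$ is the set of bitwise negations of the strings in $W$, decides whether $s$ is representable by $W$ when negation is allowed as well.
   Context: All strings lie in $\{0,1\}^m$ with $m\ge 1$, and $n\ge1$. For strings $x,y\in\{0,1\}^m$, $x\wedge y$ and $x\vee y$ denote bitwise AND and bitwise OR, and $\overline{x}$ denotes bitwise negation. A string $s$ is representable by $W$ if there is a formula whose operators are in $\{\wedge,\vee\}$ and whose operands are (at least one, possibly repeated) elements of $W$, which evaluates to $s$. "Representable when negation is allowed" means that the formula may additionally use the unary operator of bitwise negation. -}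

module Defs where

open import Data.Bool using (Bool; true; false; not; _∧_; _∨_)
open import Data.List using (List; []; _∷_)
open import Data.Nat using (ℕ; zero; suc; _+_; _∸_; _≡ᵇ_)
open import Data.Product using (∃-syntax; _×_)
open import Data.Sum using (_⊎_)
open import Data.Vec using (Vec; _∷_; map; zipWith; concat; toList)
open import Data.Vec.Membership.Propositional using (_∈_)
open import Function using (_⇔_)
open import Relation.Binary.PropositionalEquality using (_≡_; _≢_)
open import Relation.Nullary using (¬_)

Bits : ℕ → Set
Bits m = Vec Bool m

infixr 7 _AND_
infixr 6 _OR_

_AND_ _OR_ : ∀ {m} → Bits m → Bits m → Bits m
_AND_ = zipWith _∧_
_OR_  = zipWith _∨_

NOT : ∀ {m} → Bits m → Bits m
NOT = map not

data Basis : Set where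
  and-or and-or-not : Basis

-- A set of strings is given by a listing of its elements; only
-- membership in the listing matters.
data Formula {m n} (W : Vec (Bits m) n) : Basis → Set where
  operand : ∀ {b} (x : Bits m) → x ∈ W → Formula W b
  _and_   : ∀ {b} → Formula W b → Formula W b → Formula W b
  _or_    : ∀ {b} → Formula W b → Formula W b → Formula W b
  neg     : Formula W and-or-not → Formula W and-or-not

eval : ∀ {m n} {W : Vec (Bits m) n} {b} → Formula W b → Bits m
eval (operand x _) = x
eval (φ and ψ)     = eval φ AND eval ψ
eval (φ or ψ)      = eval φ OR eval ψ
eval (neg φ)       = NOT (eval φ)

RepresentableOver : ∀ {m n} → Basis → Vec (Bits m) n → Bits m → Set
RepresentableOver b W s = ∃[ φ ] eval {W = W} {b = b} φ ≡ s

Representable RepresentableWithNegation :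
  ∀ {m n} → Vec (Bits m) n → Bits m → Set
Representable             = RepresentableOver and-or
RepresentableWithNegation = RepresentableOver and-or-not

-- V may be any listing of W ∪ W̄, in any order, with or without repetitions.
ListsUnionWithNegations : ∀ {m n k} → Vec (Bits m) n → Vec (Bits m) k → Set
ListsUnionWithNegations W V = ∀ x → x ∈ V ⇔ (x ∈ W ⊎ x ∈ map NOT W)

-- Algorithms are programs of a random access machine under the uniform cost
-- criterion.  The instruction set is that of Cook and Reckhow (constants,
-- addition, truncated subtraction, indirect load and store), except that
-- control flow is structured and that registers, which are named by
-- constants in the program, are kept apart from the indirectly addressed
-- memory.

infixr 5 _⨾_

data Program : Set where
  skip           : Program
  _:=const_      : ℕ → ℕ → Program
  _:=_plus_      : ℕ → ℕ → ℕ → Program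
  _:=_minus_     : ℕ → ℕ → ℕ → Program
  _:=load_       : ℕ → ℕ → Program
  store[_]:=_    : ℕ → ℕ → Program
  _⨾_            : Program → Program → Program
  if_then_else_  : ℕ → Program → Program → Program
  while_loop_    : ℕ → Program → Program

infix 6 _:=const_ _:=_plus_ _:=_minus_ _:=load_ store[_]:=_
infix 6 if_then_else_ while_loop_

Store : Set
Store = ℕ → ℕ

infixl 9 _[_↦_]

_[_↦_] : Store → ℕ → ℕ → Store
(f [ a ↦ v ]) x with x ≡ᵇ a
... | true  = v
... | false = f x

record State : Set where
  constructor ⟪_,_⟫
  field
    reg : Store
    mem : Store

open State public

-- σ ⊢ p ⇓[ t ] τ : started in σ, the program p halts in τ after t steps.
-- The relation is deterministic in both t and τ; a diverging run has no
-- derivation.  Each instruction and each test costs one step.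
infix 4 _⊢_⇓[_]_

data _⊢_⇓[_]_ : State → Program → ℕ → State → Set where

  ⇓skip  : ∀ {σ} → σ ⊢ skip ⇓[ 1 ] σ

  ⇓const : ∀ {R M r k} →
           ⟪ R , M ⟫ ⊢ r :=const k ⇓[ 1 ] ⟪ R [ r ↦ k ] , M ⟫

  ⇓plus  : ∀ {R M r a b} →
           ⟪ R , M ⟫ ⊢ r := a plus b ⇓[ 1 ] ⟪ R [ r ↦ R a + R b ] , M ⟫

  ⇓minus : ∀ {R M r a b} →
           ⟪ R , M ⟫ ⊢ r := a minus b ⇓[ 1 ] ⟪ R [ r ↦ R a ∸ R b ] , M ⟫

  ⇓load  : ∀ {R M r a} →
           ⟪ R , M ⟫ ⊢ r :=load a ⇓[ 1 ] ⟪ R [ r ↦ M (R a) ] , M ⟫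

  ⇓store : ∀ {R M a r} →
           ⟪ R , M ⟫ ⊢ store[ a ]:= r ⇓[ 1 ] ⟪ R , M [ R a ↦ R r ] ⟫

  ⇓seq   : ∀ {σ τ υ p q t u} →
           σ ⊢ p ⇓[ t ] τ → τ ⊢ q ⇓[ u ] υ →
           σ ⊢ p ⨾ q ⇓[ t + u ] υ

  ⇓then  : ∀ {σ τ r p q t} → reg σ r ≢ 0 →
           σ ⊢ p ⇓[ t ] τ → σ ⊢ if r then p else q ⇓[ suc t ] τ

  ⇓else  : ∀ {σ τ r p q t} → reg σ r ≡ 0 →
           σ ⊢ q ⇓[ t ] τ → σ ⊢ if r then p else q ⇓[ suc t ] τ

  ⇓done  : ∀ {σ r p} → reg σ r ≡ 0 →
           σ ⊢ while r loop p ⇓[ 1 ] σ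

  ⇓loop  : ∀ {σ τ υ r p t u} → reg σ r ≢ 0 →
           σ ⊢ p ⇓[ t ] τ → τ ⊢ while r loop p ⇓[ u ] υ →
           σ ⊢ while r loop p ⇓[ suc (t + u) ] υ

contents : List Bool → Store
contents []           _       = 0
contents (true  ∷ bs) zero    = 1
contents (false ∷ bs) zero    = 0
contents (_     ∷ bs) (suc a) = contents bs a

parameters : ℕ → ℕ → Store
parameters m n 0 = m
parameters m n 1 = n
parameters m n _ = 0

-- Registers 0 and 1 hold m and n; the memory holds, one bit per cell, the
-- target s followed by the strings of W.  Everything else is 0.
input : ∀ {m n} → Vec (Bits m) n → Bits m → State
input {m} {n} W s = ⟪ parameters m n , contents (toList (concat (s ∷ W))) ⟫

record Run (p : Program) {m n} (W : Vec (Bits m) n) (s : Bits m) : Set where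
  field
    time  : ℕ
    final : State
    halts : input W s ⊢ p ⇓[ time ] final

open Run public

-- The answer is read off register 0: 1 for yes, 0 for no.
_Decides_ : ∀ {p m n} {W : Vec (Bits m) n} {s : Bits m} → Run p W s → Set → Set
r Decides P = (reg (final r) 0 ≡ 1 × P) ⊎ (reg (final r) 0 ≡ 0 × ¬ P)

{-# OPTIONS --safe #-}

-- s is a lattice combination of W iff for all positions i and j some w in W
-- has s_i ≤ w_i and w_j ≤ s_j.  A formula never takes a value that violates
-- this; conversely, choosing such a w for every pair (i, j), the string s is
-- the OR over i of the ANDs over j of the chosen strings.  The case i = j and
-- the cases s = 0…0, s = 1…1 need no separate treatment.  Three nested loops
-- test the condition in time O(m²n).  Negation is reduced to this by pushing
-- it down to the operands.
module Submission where

open import Defs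
open import Data.Bool using (Bool; true; false; not; _∧_; _∨_; b≤b)
  renaming (_≤_ to _≤ᵇ_)
open import Data.Bool.Properties as Bool using (not-involutive)
open import Data.Empty using (⊥)
open import Data.Fin using (Fin; zero; suc; toℕ; fromℕ; inject₁)
open import Data.Fin.Properties using (toℕ-fromℕ; toℕ-inject₁)
open import Data.Fin.Relation.Unary.Top using (view; ‵fromℕ; ‵inject₁)
open import Data.Nat using (ℕ; zero; suc; _+_; _∸_; _*_; _^_; _≤_; NonZero; z≤n; s≤s)
open import Data.Nat.Properties
open import Data.Nat.Tactic.RingSolver using (solve-∀)
open import Data.Product using (Σ-syntax; ∃-syntax; _×_; _,_; proj₁; proj₂)
open import Data.Sum using (_⊎_; inj₁; inj₂; [_,_]′)
open import Data.Unit using (⊤; tt)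
open import Data.Vec using (Vec; []; _∷_; map; lookup; concat; toList; _++_)
open import Data.Vec.Membership.Propositional using (_∈_; find; lose)
open import Data.Vec.Membership.Propositional.Properties using (∈-map⁺)
open import Data.Vec.Properties
  using (lookup-zipWith; tabulate∘lookup; tabulate-cong)
open import Data.Vec.Relation.Unary.Any as Any using (Any; here; there)
open import Data.Vec.Relation.Unary.Any.Properties using (map⁻)
open import Function using (_∘_; _⇔_; mk⇔; Equivalence)
open import Relation.Binary.PropositionalEquality
open import Relation.Nullary using (¬_)

open Equivalence using (to; from)

-- Lattice combinations

x∧y≤x : ∀ x y → (x ∧ y) ≤ᵇ x
x∧y≤x false _     = b≤b
x∧y≤x true  y     = Bool.≤-maximum y

x∧y≤y : ∀ x y → (x ∧ y) ≤ᵇ y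
x∧y≤y false y = Bool.≤-minimum y
x∧y≤y true  y = b≤b

x≤x∨y : ∀ x y → x ≤ᵇ (x ∨ y)
x≤x∨y false y = Bool.≤-minimum y
x≤x∨y true  y = b≤b

y≤x∨y : ∀ x y → y ≤ᵇ (x ∨ y)
y≤x∨y false y = b≤b
y≤x∨y true  y = Bool.≤-maximum y

∧-greatest : ∀ {c x y} → c ≤ᵇ x → c ≤ᵇ y → c ≤ᵇ (x ∧ y)
∧-greatest {x = true}  _ q = q
∧-greatest {x = false} p _ = p

∨-least : ∀ {c x y} → x ≤ᵇ c → y ≤ᵇ c → (x ∨ y) ≤ᵇ c
∨-least {x = false} _ q = q
∨-least {x = true}  p _ = p

-- Bits are totally ordered, so a meet is attained at one of its arguments. This fails for whole
-- strings, which is why it is used at a single position.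
∧-selective : ∀ x y → x ≤ᵇ (x ∧ y) ⊎ y ≤ᵇ (x ∧ y)
∧-selective false _ = inj₁ b≤b
∧-selective true  _ = inj₂ b≤b

∨-selective : ∀ x y → (x ∨ y) ≤ᵇ x ⊎ (x ∨ y) ≤ᵇ y
∨-selective false _ = inj₂ b≤b
∨-selective true  _ = inj₁ b≤b

module _ {m} (x y : Bits m) (i : Fin m) where

  AND-lowerˡ : lookup (x AND y) i ≤ᵇ lookup x i
  AND-lowerˡ rewrite lookup-zipWith _∧_ i x y = x∧y≤x _ _

  AND-lowerʳ : lookup (x AND y) i ≤ᵇ lookup y i
  AND-lowerʳ rewrite lookup-zipWith _∧_ i x y = x∧y≤y (lookup x i) _

  AND-greatest : ∀ {c} → c ≤ᵇ lookup x i → c ≤ᵇ lookup y i → c ≤ᵇ lookup (x AND y) i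
  AND-greatest rewrite lookup-zipWith _∧_ i x y = ∧-greatest

  AND-selective : lookup x i ≤ᵇ lookup (x AND y) i ⊎ lookup y i ≤ᵇ lookup (x AND y) i
  AND-selective rewrite lookup-zipWith _∧_ i x y = ∧-selective _ _

  OR-upperˡ : lookup x i ≤ᵇ lookup (x OR y) i
  OR-upperˡ rewrite lookup-zipWith _∨_ i x y = x≤x∨y _ _

  OR-upperʳ : lookup y i ≤ᵇ lookup (x OR y) i
  OR-upperʳ rewrite lookup-zipWith _∨_ i x y = y≤x∨y (lookup x i) _

  OR-least : ∀ {c} → lookup x i ≤ᵇ c → lookup y i ≤ᵇ c → lookup (x OR y) i ≤ᵇ c
  OR-least rewrite lookup-zipWith _∨_ i x y = ∨-least

  OR-selective : lookup (x OR y) i ≤ᵇ lookup x i ⊎ lookup (x OR y) i ≤ᵇ lookup y i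
  OR-selective rewrite lookup-zipWith _∨_ i x y = ∨-selective _ _

lookup-injective : ∀ {A : Set} {m} {x y : Vec A m} →
                   (∀ i → lookup x i ≡ lookup y i) → x ≡ y
lookup-injective {x = x} {y} eq =
  trans (sym (tabulate∘lookup x)) (trans (tabulate-cong eq) (tabulate∘lookup y))

-- Interpolation at pairs of positions

Fits : ∀ {m} → Bits m → Fin m → Fin m → Bits m → Set
Fits s i j w = lookup s i ≤ᵇ lookup w i × lookup w j ≤ᵇ lookup s j

-- Two-position interpolation in the spirit of the Baker-Pixley theorem. A pair with s_i = 1 and s_j
-- = 0 demands w_i = 1 and w_j = 0; the diagonal i = j demands w_i = s_i.
Interpolated : ∀ {m n} → Vec (Bits m) n → Bits m → Set
Interpolated W s = ∀ i j → Any (Fits s i j) W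

module _ {m n} {W : Vec (Bits m) n} where

  Any-Fits-mono : ∀ s t {i j} → lookup s i ≤ᵇ lookup t i → lookup t j ≤ᵇ lookup s j →
                  Any (Fits t i j) W → Any (Fits s i j) W
  Any-Fits-mono _ _ p q = Any.map λ (p′ , q′) → Bool.≤-trans p p′ , Bool.≤-trans q′ q

  -- At i a conjunction lies below both conjuncts, and at j it is attained by one of them; the
  -- witness of that one is inherited. Disjunction is dual, with the choice made at i.
  value-interpolated : (φ : Formula W and-or) → Interpolated W (eval φ)
  value-interpolated (operand x x∈W) i j = lose x∈W (b≤b , b≤b)
  value-interpolated (φ and ψ) i j with AND-selective (eval φ) (eval ψ) j
  ... | inj₁ φ≤ = Any-Fits-mono (eval φ AND eval ψ) (eval φ)
                    (AND-lowerˡ (eval φ) (eval ψ) i) φ≤ (value-interpolated φ i j)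
  ... | inj₂ ψ≤ = Any-Fits-mono (eval φ AND eval ψ) (eval ψ)
                    (AND-lowerʳ (eval φ) (eval ψ) i) ψ≤ (value-interpolated ψ i j)
  value-interpolated (φ or ψ) i j with OR-selective (eval φ) (eval ψ) i
  ... | inj₁ ≤φ = Any-Fits-mono (eval φ OR eval ψ) (eval φ)
                    ≤φ (OR-upperˡ (eval φ) (eval ψ) j) (value-interpolated φ i j)
  ... | inj₂ ≤ψ = Any-Fits-mono (eval φ OR eval ψ) (eval ψ)
                    ≤ψ (OR-upperʳ (eval φ) (eval ψ) j) (value-interpolated ψ i j)

  -- The index type is nonempty because no formula denotes an empty meet or join.
  ⋀ ⋁ : ∀ {b k} → (Fin (suc k) → Formula W b) → Formula W b
  ⋀ {k = zero}  f = f zero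
  ⋀ {k = suc _} f = f zero and ⋀ (f ∘ suc)
  ⋁ {k = zero}  f = f zero
  ⋁ {k = suc _} f = f zero or ⋁ (f ∘ suc)

  module _ {b : Basis} (p : Fin m) where

    ⋀-lower : ∀ {k} (f : Fin (suc k) → Formula W b) i →
              lookup (eval (⋀ f)) p ≤ᵇ lookup (eval (f i)) p
    ⋀-lower {zero}  f zero    = b≤b
    ⋀-lower {suc _} f zero    = AND-lowerˡ (eval (f zero)) (eval (⋀ (f ∘ suc))) p
    ⋀-lower {suc _} f (suc i) =
      Bool.≤-trans (AND-lowerʳ (eval (f zero)) (eval (⋀ (f ∘ suc))) p) (⋀-lower (f ∘ suc) i)

    ⋀-greatest : ∀ {k c} (f : Fin (suc k) → Formula W b) →
                 (∀ i → c ≤ᵇ lookup (eval (f i)) p) → c ≤ᵇ lookup (eval (⋀ f)) p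
    ⋀-greatest {zero}  f c≤ = c≤ zero
    ⋀-greatest {suc _} f c≤ =
      AND-greatest (eval (f zero)) (eval (⋀ (f ∘ suc))) p (c≤ zero) (⋀-greatest (f ∘ suc) (c≤ ∘ suc))

    ⋁-upper : ∀ {k} (f : Fin (suc k) → Formula W b) i →
              lookup (eval (f i)) p ≤ᵇ lookup (eval (⋁ f)) p
    ⋁-upper {zero}  f zero    = b≤b
    ⋁-upper {suc _} f zero    = OR-upperˡ (eval (f zero)) (eval (⋁ (f ∘ suc))) p
    ⋁-upper {suc _} f (suc i) =
      Bool.≤-trans (⋁-upper (f ∘ suc) i) (OR-upperʳ (eval (f zero)) (eval (⋁ (f ∘ suc))) p)

    ⋁-least : ∀ {k c} (f : Fin (suc k) → Formula W b) →
              (∀ i → lookup (eval (f i)) p ≤ᵇ c) → lookup (eval (⋁ f)) p ≤ᵇ c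
    ⋁-least {zero}  f ≤c = ≤c zero
    ⋁-least {suc _} f ≤c =
      OR-least (eval (f zero)) (eval (⋁ (f ∘ suc))) p (≤c zero) (⋁-least (f ∘ suc) (≤c ∘ suc))

interpolated⇒representable : ∀ {m n} {W : Vec (Bits (suc m)) n} {s} →
                             Interpolated W s → Representable W s
interpolated⇒representable {m} {W = W} {s} interp =
  ⋁ row , lookup-injective λ p → Bool.≤-antisym
    -- Row i contains the string chosen for (i, p), which is at most s at position p.
    (⋁-least p row λ i →
      Bool.≤-trans (⋀-lower p (chosen i) p) (proj₂ (fits i p)))
    -- Every string chosen for (p, j) is at least s at position p, hence so is row p.
    (Bool.≤-trans (⋀-greatest p (chosen p) (λ j → proj₁ (fits p j)))
      (⋁-upper p row p))
  where
  chosen : Fin (suc m) → Fin (suc m) → Formula W and-or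
  chosen i j = let w , w∈W , _ = find (interp i j) in operand w w∈W
  fits : ∀ i j → Fits s i j (eval (chosen i j))
  fits i j = proj₂ (proj₂ (find (interp i j)))
  row : Fin (suc m) → Formula W and-or
  row i = ⋀ (chosen i)

-- Without positions, interpolation would hold vacuously even for an empty `W`, while a formula has
-- at least one operand.
representable⇔interpolated : ∀ {m n} → NonZero m → {W : Vec (Bits m) n} {s : Bits m} →
                             Interpolated W s ⇔ Representable W s
representable⇔interpolated {suc _} _ =
  mk⇔ interpolated⇒representable λ { (φ , refl) → value-interpolated φ }

-- Negation normal form

NOT-involutive : ∀ {m} (x : Bits m) → NOT (NOT x) ≡ x
NOT-involutive []      = refl
NOT-involutive (b ∷ x) = cong₂ _∷_ (not-involutive b) (NOT-involutive x)

NOT-AND : ∀ {m} (x y : Bits m) → NOT (x AND y) ≡ NOT x OR NOT y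
NOT-AND []      []      = refl
NOT-AND (false ∷ x) (_ ∷ y) = cong (true ∷_) (NOT-AND x y)
NOT-AND (true  ∷ x) (b ∷ y) = cong (not b ∷_) (NOT-AND x y)

NOT-OR : ∀ {m} (x y : Bits m) → NOT (x OR y) ≡ NOT x AND NOT y
NOT-OR []      []      = refl
NOT-OR (false ∷ x) (b ∷ y) = cong (not b ∷_) (NOT-OR x y)
NOT-OR (true  ∷ x) (_ ∷ y) = cong (false ∷_) (NOT-OR x y)

∈-map-NOT⁻ : ∀ {m n} {W : Vec (Bits m) n} {x} → x ∈ map NOT W → NOT x ∈ W
∈-map-NOT⁻ {W = W} {x} x∈ with find (map⁻ x∈)
... | w , w∈W , refl = subst (_∈ W) (sym (NOT-involutive w)) w∈W

module _ {m n k} {W : Vec (Bits m) n} {V : Vec (Bits m) k}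
         (lists : ListsUnionWithNegations W V) where

  -- Both polarities are carried through one induction: De Morgan exchanges `and` with `or` in the
  -- negative component, and `neg` swaps the two components.
  negation-normal : (φ : Formula W and-or-not) →
                    Representable V (eval φ) × Representable V (NOT (eval φ))
  negation-normal (operand x x∈W) =
    (operand x (from (lists x) (inj₁ x∈W)) , refl) ,
    (operand (NOT x) (from (lists (NOT x)) (inj₂ (∈-map⁺ NOT x∈W))) , refl)
  negation-normal (φ and ψ) with negation-normal φ | negation-normal ψ
  ... | (φ⁺ , p) , (φ⁻ , p′) | (ψ⁺ , q) , (ψ⁻ , q′) =
    (φ⁺ and ψ⁺ , cong₂ _AND_ p q) ,
    (φ⁻ or ψ⁻ , trans (cong₂ _OR_ p′ q′) (sym (NOT-AND (eval φ) (eval ψ))))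
  negation-normal (φ or ψ) with negation-normal φ | negation-normal ψ
  ... | (φ⁺ , p) , (φ⁻ , p′) | (ψ⁺ , q) , (ψ⁻ , q′) =
    (φ⁺ or ψ⁺ , cong₂ _OR_ p q) ,
    (φ⁻ and ψ⁻ , trans (cong₂ _AND_ p′ q′) (sym (NOT-OR (eval φ) (eval ψ))))
  negation-normal (neg φ) with negation-normal φ
  ... | (φ⁺ , p) , φ⁻ = φ⁻ , (φ⁺ , trans p (sym (NOT-involutive (eval φ))))

  with-negations : (φ : Formula V and-or) → RepresentableWithNegation W (eval φ)
  with-negations (operand x x∈V) with to (lists x) x∈V
  ... | inj₁ x∈W = operand x x∈W , refl
  ... | inj₂ x∈  = neg (operand (NOT x) (∈-map-NOT⁻ x∈)) , NOT-involutive x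
  with-negations (φ and ψ) with with-negations φ | with-negations ψ
  ... | φ′ , p | ψ′ , q = φ′ and ψ′ , cong₂ _AND_ p q
  with-negations (φ or ψ) with with-negations φ | with-negations ψ
  ... | φ′ , p | ψ′ , q = φ′ or ψ′ , cong₂ _OR_ p q

  representable⇔withNegation : ∀ {s} → Representable V s ⇔ RepresentableWithNegation W s
  representable⇔withNegation =
    mk⇔ (λ { (φ , refl) → with-negations φ })
        (λ { (φ , refl) → proj₁ (negation-normal φ) })

-- The program

#m #n #one #zero #answer #i #j #k #sᵢ #sⱼ #found #p #q #x #y : ℕ
#m      = 0
#n      = 1
#one    = 2
#zero   = 3
#answer = 4
#i      = 5
#j      = 6
#k      = 7
#sᵢ     = 8
#sⱼ     = 9
#found  = 10
#p      = 11
#q      = 12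
#x      = 13
#y      = 14

-- #p and #q point to the bits i and j of the current string w.  The amount
-- added to #found is 1 if s_i ≤ w_i and w_j ≤ s_j, and 0 otherwise.
scanString : Program
scanString =
  #k     := #k minus #one ⨾
  #x     :=load #p ⨾
  #y     :=load #q ⨾
  #x     := #sᵢ minus #x ⨾
  #y     := #y minus #sⱼ ⨾
  #x     := #x plus #y ⨾
  #x     := #one minus #x ⨾
  #found := #found plus #x ⨾
  #p     := #p plus #m ⨾
  #q     := #q plus #m

scanPair : Program
scanPair =
  -- Decrementing first turns the counter into the index j, which is also the address of s_j, since
  -- s starts at address 0.
  #j      := #j minus #one ⨾
  #sⱼ     :=load #j ⨾
  #found  :=const 0 ⨾
  -- The first string of W starts at address m, right after s.
  #p      := #i plus #m ⨾
  #q      := #j plus #m ⨾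
  #k      := #n plus #zero ⨾
  while #k loop scanString ⨾
  -- `#x` becomes 1 only if no string fitted; subtracting it then drops the answer to 0, where
  -- truncation keeps it.
  #x      := #one minus #found ⨾
  #answer := #answer minus #x

scanRow : Program
scanRow =
  #i  := #i minus #one ⨾
  #sᵢ :=load #i ⨾
  #j  := #m plus #zero ⨾
  while #j loop scanPair

decideRepresentable : Program
decideRepresentable =
  #one    :=const 1 ⨾
  #zero   :=const 0 ⨾
  #answer :=const 1 ⨾
  #i      := #m plus #zero ⨾
  while #i loop scanRow ⨾
  -- Register 0 holds m throughout the loops and can take the answer only now.
  #m      := #answer plus #zero

-- Exact running time and its bound

loopTime : ℕ → ℕ → ℕ
-- The final, failing test costs a step too. Times are exact because the program never branches
-- except to leave a loop.
loopTime t zero    = 1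
loopTime t (suc k) = suc (t + loopTime t k)

pairTime : ℕ → ℕ
pairTime n = 6 + (loopTime 10 n + 2)

rowTime : ℕ → ℕ → ℕ
rowTime m n = 3 + loopTime (pairTime n) m

totalTime : ℕ → ℕ → ℕ
totalTime m n = 4 + (loopTime (rowTime m n) m + 1)

loopTime-closed : ∀ t k → loopTime t k ≡ 1 + k * (1 + t)
loopTime-closed t zero    = refl
loopTime-closed t (suc k) rewrite loopTime-closed t k = cong suc (+-suc t (k * suc t))

totalTime-closed : ∀ m n → totalTime m n ≡ 6 + 5 * m + 10 * (m * m) + 11 * (m * m * n)
totalTime-closed m n
  rewrite loopTime-closed (rowTime m n) m | loopTime-closed (pairTime n) m
        | loopTime-closed 10 n = polynomial m n
  where
  polynomial : ∀ m n →
    4 + (1 + m * (1 + (3 + (1 + m * (1 + (6 + (1 + n * 11 + 2)))))) + 1) ≡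
    6 + 5 * m + 10 * (m * m) + 11 * (m * m * n)
  polynomial = solve-∀

totalTime-bound : ∀ m n → NonZero m → NonZero n → totalTime m n ≤ 32 * (m ^ 2 * n)
totalTime-bound m@(suc _) n@(suc _) _ _ = begin
  totalTime m n
    ≡⟨ totalTime-closed m n ⟩
  6 + 5 * m + 10 * (m * m) + 11 * X
    -- As m and n are positive, each of 1, m and m² is at most m²n; the coefficients 6, 5, 10 and 11
    -- add up to 32.
    ≤⟨ +-monoˡ-≤ (11 * X) (+-mono-≤ (+-mono-≤ (*-monoʳ-≤ 6 1≤X) (*-monoʳ-≤ 5 m≤X))
                                    (*-monoʳ-≤ 10 mm≤X)) ⟩
  6 * X + 5 * X + 10 * X + 11 * X
    ≡⟨ collect X ⟩
  32 * X
    -- `m ^ 2` unfolds to `m * (m * 1)`.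
    ≡⟨ cong (λ z → 32 * (m * z * n)) (sym (*-identityʳ m)) ⟩
  32 * (m ^ 2 * n) ∎
  where
  open ≤-Reasoning
  X = m * m * n
  mm≤X : m * m ≤ X
  mm≤X = m≤m*n (m * m) n
  m≤X : m ≤ X
  m≤X = ≤-trans (m≤m*n m m) mm≤X
  1≤X : 1 ≤ X
  1≤X = ≤-trans (s≤s z≤n) m≤X
  collect : ∀ X → 6 * X + 5 * X + 10 * X + 11 * X ≡ 32 * X
  collect = solve-∀

-- Truth values in registers

-- `Answers` is `Decides` for an arbitrary register value. `Signals` allows any positive value, as
-- `#found` counts the fitting strings.
Answers Signals : ℕ → Set → Set
Answers v P = (v ≡ 1 × P) ⊎ (v ≡ 0 × ¬ P)
Signals v P = (1 ≤ v × P) ⊎ (v ≡ 0 × ¬ P)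

Answers-⇔ : ∀ {v P Q} → P ⇔ Q → Answers v P → Answers v Q
Answers-⇔ P⇔Q (inj₁ (eq , p))  = inj₁ (eq , to P⇔Q p)
Answers-⇔ P⇔Q (inj₂ (eq , ¬p)) = inj₂ (eq , ¬p ∘ from P⇔Q)

Signals-⇔ : ∀ {v P Q} → P ⇔ Q → Signals v P → Signals v Q
Signals-⇔ P⇔Q (inj₁ (le , p))  = inj₁ (le , to P⇔Q p)
Signals-⇔ P⇔Q (inj₂ (eq , ¬p)) = inj₂ (eq , ¬p ∘ from P⇔Q)

Signals-⊎ : ∀ {u v P Q} → Signals u P → Answers v Q → Signals (u + v) (P ⊎ Q)
Signals-⊎ (inj₁ (le , p))    _                  = inj₁ (m≤n⇒m≤n+o _ le , inj₁ p)
Signals-⊎ {u} (inj₂ _)       (inj₁ (refl , q))  = inj₁ (m≤n+m 1 u , inj₂ q)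
Signals-⊎ (inj₂ (refl , ¬p)) (inj₂ (refl , ¬q)) = inj₂ (refl , [ ¬p , ¬q ]′)

Answers-× : ∀ {u v P Q} → Answers u P → Signals v Q → Answers (u ∸ (1 ∸ v)) (P × Q)
Answers-× {u} (inj₁ (refl , p)) (inj₁ (le , q)) =
  inj₁ (cong (u ∸_) (m≤n⇒m∸n≡0 le) , p , q)
Answers-× (inj₁ (refl , p))  (inj₂ (refl , ¬q)) = inj₂ (refl , ¬q ∘ proj₂)
Answers-× {v = v} (inj₂ (refl , ¬p)) _          = inj₂ (0∸n≡0 (1 ∸ v) , ¬p ∘ proj₁)

bit : Bool → ℕ
bit false = 0
bit true  = 1

-- For bits, truncated subtraction gives 1 exactly when ≤ fails, so the inner sum counts violations
-- and the outer subtraction tests it for 0.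
fits-answer : ∀ a x y b →
  Answers (1 ∸ ((bit a ∸ bit x) + (bit y ∸ bit b))) (a ≤ᵇ x × y ≤ᵇ b)
fits-answer true  false y     b     = inj₂ (0∸n≡0 (bit y ∸ bit b) , λ { (() , _) })
fits-answer false x     false b     rewrite 0∸n≡0 (bit x) | 0∸n≡0 (bit b) =
  inj₁ (refl , Bool.≤-minimum x , Bool.≤-minimum b)
fits-answer false x     true  false rewrite 0∸n≡0 (bit x) = inj₂ (refl , λ { (_ , ()) })
fits-answer false x     true  true  rewrite 0∸n≡0 (bit x) =
  inj₁ (refl , Bool.≤-minimum x , b≤b)
fits-answer true  true  false b     rewrite 0∸n≡0 (bit b) =
  inj₁ (refl , b≤b , Bool.≤-minimum b)
fits-answer true  true  true  false = inj₂ (refl , λ { (_ , ()) })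
fits-answer true  true  true  true  = inj₁ (refl , b≤b , b≤b)

-- Strings in memory

-- The base is the right summand, as in `#i plus #m`, so pointer values match without rearrangement.
Holds : ∀ {m} → Store → ℕ → Bits m → Set
Holds M b x = ∀ i → M (toℕ i + b) ≡ bit (lookup x i)

HoldsAll : ∀ {m n} → Store → ℕ → Vec (Bits m) n → Set
HoldsAll         M b []      = ⊤
HoldsAll {m = m} M b (x ∷ W) = Holds M b x × HoldsAll M (b + m) W

contents-++ˡ : ∀ {m n} (x : Bits m) (y : Bits n) i →
               contents (toList (x ++ y)) (toℕ i) ≡ bit (lookup x i)
contents-++ˡ (true  ∷ x) y zero    = refl
contents-++ˡ (false ∷ x) y zero    = refl
contents-++ˡ (true  ∷ x) y (suc i) = contents-++ˡ x y i
contents-++ˡ (false ∷ x) y (suc i) = contents-++ˡ x y i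

contents-++ʳ : ∀ {m n} (x : Bits m) (y : Bits n) a →
               contents (toList (x ++ y)) (m + a) ≡ contents (toList y) a
contents-++ʳ []          y a = refl
contents-++ʳ (true  ∷ x) y a = contents-++ʳ x y a
contents-++ʳ (false ∷ x) y a = contents-++ʳ x y a

holdsAll : ∀ {m n M} b (W : Vec (Bits m) n) →
           (∀ a → M (a + b) ≡ contents (toList (concat W)) a) → HoldsAll M b W
holdsAll b []      _  = tt
holdsAll {m} {M = M} b (x ∷ W) eq =
  (λ i → trans (eq (toℕ i)) (contents-++ˡ x (concat W) i)) ,
  holdsAll (b + m) W λ a →
    trans (cong M (shift a b m)) (trans (eq (m + a)) (contents-++ʳ x (concat W) a))
  where
  shift : ∀ a b m → a + (b + m) ≡ (m + a) + b
  shift = solve-∀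

-- Correctness of the program

-- The top index is split off because counters run downwards: the first pass treats `fromℕ k`, the
-- later ones the indices below it.
Fin-suc-∀ : ∀ {k} {P : Set} {G : Fin (suc k) → Set} →
            ((P × G (fromℕ k)) × (∀ i → G (inject₁ i))) ⇔ (P × (∀ i → G i))
Fin-suc-∀ {G = G} = mk⇔ (λ { ((p , g) , gs) → p , extend g gs })
                        (λ { (p , gs) → (p , gs _) , λ i → gs _ })
  where
  extend : G (fromℕ _) → (∀ i → G (inject₁ i)) → ∀ i → G i
  extend g gs i with view i
  ... | ‵fromℕ     = g
  ... | ‵inject₁ j = gs j

suc≢0 : ∀ {v k} → v ≡ suc k → v ≢ 0
suc≢0 refl ()

module _ (M : Store) where

  -- `P` is the conjunction of all tests made so far. The counter stays outside `Inv` because the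
  -- body changes it.
  ∀-Step : (c t : ℕ) (body : Program) (Inv : Store → Set) {k : ℕ}
           (G : Fin k → Set) → Set₁
  ∀-Step c t body Inv G = ∀ {P R} i → Inv R → R c ≡ suc (toℕ i) → Answers (R #answer) P →
    Σ[ R′ ∈ Store ] ⟪ R , M ⟫ ⊢ body ⇓[ t ] ⟪ R′ , M ⟫ ×
                    Inv R′ × R′ c ≡ toℕ i × Answers (R′ #answer) (P × G i)

  ∀-loop : ∀ {c t body Inv k} {G : Fin k → Set} → ∀-Step c t body Inv G →
           ∀ {P R} → Inv R → R c ≡ k → Answers (R #answer) P →
           Σ[ R′ ∈ Store ] ⟪ R , M ⟫ ⊢ while c loop body ⇓[ loopTime t k ] ⟪ R′ , M ⟫ ×
                           Inv R′ × Answers (R′ #answer) (P × (∀ i → G i))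
  ∀-loop {k = zero} step inv c≡0 ans =
    _ , ⇓done c≡0 , inv , Answers-⇔ (mk⇔ (_, λ ()) proj₁) ans
  ∀-loop {c} {t} {body} {Inv} {suc k} {G} step inv c≡ ans
    with step (fromℕ k) inv (trans c≡ (cong suc (sym (toℕ-fromℕ k)))) ans
  ... | R₁ , run₁ , inv₁ , c≡₁ , ans₁
    with ∀-loop {Inv = Inv} {G = G ∘ inject₁} step′ inv₁ (trans c≡₁ (toℕ-fromℕ k)) ans₁
    where
    -- The remaining passes form a loop over k indices, embedded by `inject₁` without changing their
    -- values.
    step′ : ∀-Step c t body Inv (G ∘ inject₁)
    step′ i inv′ eq ans′ with step (inject₁ i) inv′ (trans eq (cong suc (sym (toℕ-inject₁ i)))) ans′
    ... | R″ , run , inv″ , eq″ , ans″ = R″ , run , inv″ , trans eq″ (toℕ-inject₁ i) , ans″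
  ... | R₂ , run₂ , inv₂ , ans₂ =
    R₂ , ⇓loop (suc≢0 c≡) run₁ run₂ , inv₂ , Answers-⇔ Fin-suc-∀ ans₂

module _ {m n} (M : Store) (W : Vec (Bits m) n) (s : Bits m)
         (holds-s : Holds M 0 s) (holds-W : HoldsAll M m W) where

  -- Products rather than records, so that updating an unrelated register
  -- leaves them definitionally unchanged.
  Global : Store → Set
  Global R = R #m ≡ m × R #n ≡ n × R #one ≡ 1 × R #zero ≡ 0

  Row : Fin m → Store → Set
  Row i R = Global R × R #i ≡ toℕ i × R #sᵢ ≡ bit (lookup s i)

  Pair : Fin m → Fin m → Store → Set
  Pair i j R = Row i R × R #j ≡ toℕ j × R #sⱼ ≡ bit (lookup s j)

  load-s : ∀ {a} i → a ≡ toℕ i → M a ≡ bit (lookup s i)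
  load-s i refl = trans (cong M (sym (+-identityʳ (toℕ i)))) (holds-s i)

  -- For the induction on the strings still to be read, the base address `b` moves along by m, and
  -- `Q` records whether an earlier string fitted.
  scan-correct : ∀ {i j l P R} b (U : Vec (Bits m) l) → HoldsAll M b U →
    Pair i j R → Answers (R #answer) P → R #k ≡ l →
    R #p ≡ toℕ i + b → R #q ≡ toℕ j + b → ∀ {Q} → Signals (R #found) Q →
    Σ[ R′ ∈ Store ] ⟪ R , M ⟫ ⊢ while #k loop scanString ⇓[ loopTime 10 l ] ⟪ R′ , M ⟫ ×
      Pair i j R′ × Answers (R′ #answer) P × Signals (R′ #found) (Q ⊎ Any (Fits s i j) U)
  scan-correct b [] _ pair ans k≡0 _ _ found =
    _ , ⇓done k≡0 , pair , ans ,
    Signals-⇔ (mk⇔ inj₁ λ { (inj₁ q) → q ; (inj₂ ()) }) found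
  scan-correct {i} {j} {R = R} b (w ∷ U) (holds-w , holds-U)
    pair@(((m≡ , _ , one≡ , _) , _ , sᵢ≡) , _ , sⱼ≡) ans k≡ p≡ q≡ found
    with scan-correct (b + m) U holds-U pair ans
           (cong₂ _∸_ k≡ one≡) (advance p≡) (advance q≡)
           (Signals-⊎ found (subst (λ v → Answers v (Fits s i j w)) (sym value) (fits-answer _ _ _ _)))
    where
    advance : ∀ {v a} → v ≡ a + b → v + R #m ≡ a + (b + m)
    advance {a = a} v≡ = trans (cong₂ _+_ v≡ m≡) (+-assoc a b m)
    value : R #one ∸ ((R #sᵢ ∸ M (R #p)) + (M (R #q) ∸ R #sⱼ)) ≡
            1 ∸ ((bit (lookup s i) ∸ bit (lookup w i)) + (bit (lookup w j) ∸ bit (lookup s j)))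
    value = cong₂ _∸_ one≡ (cong₂ _+_
      (cong₂ _∸_ sᵢ≡ (trans (cong M p≡) (holds-w i)))
      (cong₂ _∸_ (trans (cong M q≡) (holds-w j)) sⱼ≡))
  ... | R′ , run , pair′ , ans′ , found′ =
    R′ ,
    ⇓loop (suc≢0 k≡)
      (⇓seq ⇓minus (⇓seq ⇓load (⇓seq ⇓load (⇓seq ⇓minus (⇓seq ⇓minus
      (⇓seq ⇓plus (⇓seq ⇓minus (⇓seq ⇓plus (⇓seq ⇓plus ⇓plus)))))))))
      run ,
    pair′ , ans′ , Signals-⇔ (mk⇔ regroup ungroup) found′
    where
    regroup : ∀ {Q} → (Q ⊎ Fits s i j w) ⊎ Any (Fits s i j) U → Q ⊎ Any (Fits s i j) (w ∷ U)
    regroup (inj₁ (inj₁ q)) = inj₁ q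
    regroup (inj₁ (inj₂ f)) = inj₂ (here f)
    regroup (inj₂ fs)       = inj₂ (there fs)
    ungroup : ∀ {Q} → Q ⊎ Any (Fits s i j) (w ∷ U) → (Q ⊎ Fits s i j w) ⊎ Any (Fits s i j) U
    ungroup (inj₁ q)          = inj₁ (inj₁ q)
    ungroup (inj₂ (here f))   = inj₁ (inj₂ f)
    ungroup (inj₂ (there fs)) = inj₂ fs

  scanPair-correct : ∀ i →
    ∀-Step M #j (pairTime n) scanPair (Row i) (λ j → Any (Fits s i j) W)
  scanPair-correct i {R = R} j
    row@((m≡ , n≡ , one≡ , zero≡) , i≡ , _) j≡ ans
    with scan-correct m W holds-W (row , j≡′ , load-s j j≡′) ans
           (trans (cong₂ _+_ n≡ zero≡) (+-identityʳ n))
           -- No string has been read yet, so the disjunction starts from ⊥ with `#found` at 0.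
           (cong₂ _+_ i≡ m≡) (cong₂ _+_ j≡′ m≡) {⊥} (inj₂ (refl , λ ()))
    where
    j≡′ : R #j ∸ R #one ≡ toℕ j
    j≡′ = cong₂ _∸_ j≡ one≡
  ... | R′ , run , (row′@((_ , _ , one≡′ , _) , _) , j≡″ , _) , ans′ , found =
    _ ,
    ⇓seq ⇓minus (⇓seq ⇓load (⇓seq ⇓const (⇓seq ⇓plus (⇓seq ⇓plus (⇓seq ⇓plus
    (⇓seq run (⇓seq ⇓minus ⇓minus))))))) ,
    row′ , j≡″ ,
    subst (λ o → Answers (R′ #answer ∸ (o ∸ R′ #found)) _) (sym one≡′)
      (Answers-× ans′ (Signals-⇔ (mk⇔ (λ { (inj₁ ()) ; (inj₂ f) → f }) inj₂) found))

  scanRow-correct :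
    ∀-Step M #i (rowTime m n) scanRow Global (λ i → ∀ j → Any (Fits s i j) W)
  scanRow-correct {R = R} i global@(m≡ , _ , one≡ , zero≡) i≡ ans
    with ∀-loop M {Inv = Row i} (scanPair-correct i) (global , i≡′ , load-s i i≡′)
           (trans (cong₂ _+_ m≡ zero≡) (+-identityʳ m)) ans
    where
    i≡′ : R #i ∸ R #one ≡ toℕ i
    i≡′ = cong₂ _∸_ i≡ one≡
  ... | R′ , run , (global′ , i≡″ , _) , ans′ =
    R′ , ⇓seq ⇓minus (⇓seq ⇓load (⇓seq ⇓plus run)) , global′ , i≡″ , ans′

  decideRepresentable-correct :
    Σ[ R′ ∈ Store ]
      ⟪ parameters m n , M ⟫ ⊢ decideRepresentable ⇓[ totalTime m n ] ⟪ R′ , M ⟫ ×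
      Answers (R′ #m) (Interpolated W s)
  decideRepresentable-correct
    -- The conjunction starts from ⊤ with the answer register at 1.
    with ∀-loop M {Inv = Global} scanRow-correct {⊤} {start} (refl , refl , refl , refl)
           (+-identityʳ m) (inj₁ (refl , tt))
    where
    start = parameters m n [ #one ↦ 1 ] [ #zero ↦ 0 ] [ #answer ↦ 1 ] [ #i ↦ m + 0 ]
  ... | R′ , run , (_ , _ , _ , zero≡) , ans =
    _ ,
    ⇓seq ⇓const (⇓seq ⇓const (⇓seq ⇓const (⇓seq ⇓plus (⇓seq run ⇓plus)))) ,
    subst (λ v → Answers v _) (sym (trans (cong (R′ #answer +_) zero≡) (+-identityʳ _)))
      (Answers-⇔ (mk⇔ proj₂ (tt ,_)) ans)

-- The number of strings is arbitrary, so this applies equally to `W` and to any listing of its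
-- union with the negations.
decideRepresentable-run : ∀ {m n} → NonZero m → (W : Vec (Bits m) n) (s : Bits m) →
  Σ[ r ∈ Run decideRepresentable W s ] time r ≡ totalTime m n × r Decides Representable W s
decideRepresentable-run {m} {n} m≢0 W s
  -- Taking s as the first string of one list locates both parts: the base of W is 0 + m, which
  -- reduces to m.
  with holdsAll 0 (s ∷ W) (λ a → cong (contents (toList (concat (s ∷ W)))) (+-identityʳ a))
... | holds-s , holds-W with decideRepresentable-correct _ W s holds-s holds-W
... | R , run , ans =
  record { time = totalTime m n ; final = _ ; halts = run } , refl ,
  Answers-⇔ (representable⇔interpolated m≢0) ans

mainTheorem1 : Σ[ A ∈ Program ]
    ( ( ∃[ C ] ( ∀ (m n : ℕ) → NonZero m → NonZero n →
    (W : Vec (Bits m) n) (s : Bits m) →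
    Σ[ r ∈ Run A W s ]
    ( time r ≤ C * (m ^ 2 * n) × r Decides Representable W s ) ) )
    × ( ∀ (m n k : ℕ) → NonZero m → NonZero n →
    (W : Vec (Bits m) n) (V : Vec (Bits m) k) (s : Bits m) →
    ListsUnionWithNegations W V →
    Σ[ r ∈ Run A V s ] r Decides RepresentableWithNegation W s ) )
mainTheorem1 = decideRepresentable , (32 , timed) , negated
  where
  timed : ∀ m n → NonZero m → NonZero n → (W : Vec (Bits m) n) (s : Bits m) →
    Σ[ r ∈ Run decideRepresentable W s ]
      (time r ≤ 32 * (m ^ 2 * n) × r Decides Representable W s)
  timed m n m≢0 n≢0 W s with decideRepresentable-run m≢0 W s
  ... | r , time≡ , decides =
    r , subst (_≤ _) (sym time≡) (totalTime-bound m n m≢0 n≢0) , decides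
  negated : ∀ m n k → NonZero m → NonZero n →
    (W : Vec (Bits m) n) (V : Vec (Bits m) k) (s : Bits m) → ListsUnionWithNegations W V →
    Σ[ r ∈ Run decideRepresentable V s ] r Decides RepresentableWithNegation W s
  negated m n k m≢0 _ W V s lists with decideRepresentable-run m≢0 V s
  ... | r , _ , decides = r , Answers-⇔ (representable⇔withNegation lists) decides
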